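{- Let $f,g:\{0,1\}^n\to\{0,1\}$ be balanced Boolean functions. If $f$ is NPN-equivalent to $g$, then either ($OSV^1(f)=OSV^1(g)$ and $OSV^0(f)=OSV^0(g)$) or ($OSV^1(f)=OSV^0(g)$ and $OSV^0(f)=OSV^1(g)$).
   Context: For a word $X=(x_1,\dots,x_n)\in\{0,1\}^n$, $X^i$ denotes $X$ with its $i$-th bit negated. A selective negation $(\neg)$ is a map $\{0,1\}^n\to\{0,1\}^n$ that negates the bits in some fixed set of positions and leaves the others unchanged. A permutation $\pi$ acts on words by reordering their entries. $f$ is NPN-equivalent to $g$ if there are a permutation $\pi$ and a selective negation $(\neg)$ such that either $f(\pi((\neg)X))=g(X)$ for all $X\in\{0,1\}^n$, or $\neg f(\pi((\neg)X))=g(X)$ for all $X\in\{0,1\}^n$ (i.e. input negation, input permutation and possibly output negation). A function $f$ on $n$ variables is balanced if $|f^{ -1}(1)|=|f^{ -1}(0)|=2^{n-1}$. The local sensitivity of $f$ at $X$ is $sen(f,X)=|\{i\in\{1,\dots,n\}: f(X)\neq f(X^i)\}|$. For $b\in\{0,1\}$, the ordered $b$-sensitivity vector is $OSV^b(f)=\{sen(f,X): X\in\{0,1\}^n,\ f(X)=b\}_\le$, where $\{\cdot\}_\le$ denotes the multiset (with multiplicities) listed in non-decreasing order. -}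

module Defs where

open import Data.Bool.Base using (Bool; true; false; not; if_then_else_)
open import Data.Bool.Properties using (_≟_)
open import Data.Fin.Base using (Fin)
open import Data.Fin.Permutation using (Permutation′; _⟨$⟩ʳ_)
open import Data.Fin.Subset using (Subset)
open import Data.List.Base using (List; []; _∷_; _++_; map; filter; length; allFin)
open import Data.List.Membership.Propositional using (_∈_)
open import Data.List.Membership.Propositional.Properties using (∈-++⁺ˡ; ∈-++⁺ʳ; ∈-map⁺; ∈-map⁻)
open import Data.List.Relation.Unary.Any using (here)
open import Data.List.Relation.Unary.All using ([])
open import Data.List.Relation.Unary.AllPairs using ([]; _∷_)
open import Data.List.Relation.Unary.Unique.Propositional using (Unique)
import Data.List.Relation.Unary.Unique.Propositional.Properties as Unique
open import Data.List.Sort using (sort)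
open import Data.Nat.Base using (ℕ; zero; suc; _∸_; _^_)
open import Data.Nat.Properties using (≤-decTotalOrder)
open import Data.Product.Base using (_×_; _,_; ∃-syntax)
open import Data.Sum.Base using (_⊎_)
open import Data.Vec.Base using (Vec; []; _∷_; lookup; tabulate; zipWith; updateAt)
open import Data.Vec.Properties using (∷-injectiveʳ)
open import Relation.Binary.PropositionalEquality using (_≡_; refl)
open import Relation.Nullary.Decidable using (¬?)

Word : ℕ → Set
Word n = Vec Bool n

BoolFun : ℕ → Set
BoolFun n = Word n → Bool

flipBit : ∀ {n} → Word n → Fin n → Word n
flipBit X i = updateAt X i not

-- The argument S is the fixed set of negated positions.
selectiveNegation : ∀ {n} → Subset n → Word n → Word n
selectiveNegation = zipWith (λ s x → if s then not x else x)

permute : ∀ {n} → Permutation′ n → Word n → Word n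
permute π X = tabulate (λ i → lookup X (π ⟨$⟩ʳ i))

NPNEquivalent : ∀ {n} → BoolFun n → BoolFun n → Set
NPNEquivalent {n} f g =
  ∃[ π ] ∃[ S ] ( (∀ (X : Word n) → f (permute π (selectiveNegation S X)) ≡ g X)
                ⊎ (∀ (X : Word n) → not (f (permute π (selectiveNegation S X))) ≡ g X))

words : ∀ n → List (Word n)
words zero    = [] ∷ []
words (suc n) = map (false ∷_) (words n) ++ map (true ∷_) (words n)

-- ∈-words and words-unique: words n lists every word exactly once, so that
-- lengths and multisets computed from it carry the right multiplicities.
∈-words : ∀ {n} (X : Word n) → X ∈ words n
∈-words []          = here refl
∈-words (false ∷ X) = ∈-++⁺ˡ (∈-map⁺ (false ∷_) (∈-words X))
∈-words (true  ∷ X) = ∈-++⁺ʳ (map (false ∷_) (words _)) (∈-map⁺ (true ∷_) (∈-words X))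

words-unique : ∀ n → Unique (words n)
words-unique zero    = [] ∷ []
words-unique (suc n) = Unique.++⁺
  (Unique.map⁺ ∷-injectiveʳ (words-unique n))
  (Unique.map⁺ ∷-injectiveʳ (words-unique n))
  λ (p , q) → disjoint (∈-map⁻ (false ∷_) p) (∈-map⁻ (true ∷_) q)
  where
  open import Data.Empty using (⊥)
  disjoint : ∀ {X : Word (suc n)} →
             ∃[ Y ] (Y ∈ words n × X ≡ false ∷ Y) →
             ∃[ Z ] (Z ∈ words n × X ≡ true ∷ Z) → ⊥
  disjoint (_ , _ , refl) (_ , _ , ())

preimage : ∀ {n} → BoolFun n → Bool → List (Word n)
preimage f b = filter (λ X → f X ≟ b) (words _)

-- For n = 0 the truncated exponent is harmless: the two preimages have
-- total size 1, so they cannot both have size 2 ^ 0 and no f is balanced.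
Balanced : ∀ {n} → BoolFun n → Set
Balanced {n} f = length (preimage f true)  ≡ 2 ^ (n ∸ 1)
               × length (preimage f false) ≡ 2 ^ (n ∸ 1)

sen : ∀ {n} → BoolFun n → Word n → ℕ
sen {n} f X = length (filter (λ i → ¬? (f X ≟ f (flipBit X i))) (allFin n))

OSV : ∀ {n} → Bool → BoolFun n → List ℕ
OSV b f = sort ≤-decTotalOrder (map (sen f) (preimage f b))

{-# OPTIONS --safe #-}

-- The input transformation T = π ∘ (¬) is a bijection of {0,1}ⁿ which carries
-- the neighbours of X to the neighbours of T X: flipping bit i of T X is the
-- same as applying T after flipping bit π i of X.  An output negation preserves
-- inequality of values.  Hence sen g X = sen f (T X), and T maps g⁻¹(b) onto
-- f⁻¹(b), or onto f⁻¹(¬ b) if the output is negated; so the corresponding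
-- multisets of sensitivities agree.
module Submission where

open import Defs
open import Data.Bool.Base using (Bool; true; false; not; if_then_else_)
open import Data.Bool.Properties using (not-injective) renaming (_≟_ to _≟ᵇ_)
open import Data.Fin.Base using (Fin; zero; suc)
open import Data.Fin.Permutation using (Permutation′; _⟨$⟩ʳ_; inverseˡ; inverseʳ; flip)
open import Data.Fin.Properties using (_≟_)
open import Data.Fin.Subset using (Subset)
open import Data.List.Base using (List; []; _∷_; map; filter; length; allFin)
open import Data.List.Membership.Propositional using (_∈_)
open import Data.List.Membership.Propositional.Properties using (∈-map⁺; ∈-allFin)
open import Data.List.Membership.Propositional.Properties.WithK using (unique∧set⇒bag)
open import Data.List.Properties using (map-∘; map-cong; length-map; filter-≐)
open import Data.List.Relation.Binary.BagAndSetEquality using (∼bag⇒↭)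
open import Data.List.Relation.Binary.Equality.Propositional using (≋⇒≡)
open import Data.List.Relation.Binary.Permutation.Propositional using (_↭_; ↭-sym; ↭-trans; ↭⇒↭ₛ; module PermutationReasoning)
open import Data.List.Relation.Binary.Permutation.Propositional.Properties using (map⁺; filter-↭; ↭-length)
open import Data.List.Relation.Unary.Sorted.TotalOrder.Properties using (↗↭↗⇒≋)
open import Data.List.Relation.Unary.Unique.Propositional using (Unique)
import Data.List.Relation.Unary.Unique.Propositional.Properties as Unique
open import Data.List.Sort using (sort; sort-↭; sort-↗)
open import Data.Nat.Base using (ℕ)
open import Data.Nat.Properties using (≤-decTotalOrder; ≤-totalOrder)
open import Data.Product.Base using (_×_; _,_; proj₁; proj₂)
open import Data.Sum.Base using (_⊎_; inj₁; inj₂)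
open import Data.Vec.Base using ([]; _∷_; lookup)
open import Data.Vec.Properties using (lookup∘tabulate; tabulate∘lookup; tabulate-cong; lookup∘updateAt; lookup∘updateAt′)
open import Function.Base using (_∘_; id)
open import Function.Bundles using (_↔_; Inverse; Injection; mk↔ₛ′; mk⇔)
open import Function.Construct.Composition using (_↔-∘_)
open import Function.Definitions using (Injective)
open import Function.Properties.Inverse using (↔⇒↣)
open import Relation.Binary.PropositionalEquality using (_≡_; _≗_; refl; sym; trans; cong; subst; module ≡-Reasoning)
open import Relation.Nullary.Decidable using (does; yes; no; ¬?)
open import Relation.Nullary.Negation using (¬_)
open import Relation.Unary using (Pred; Decidable)

open Inverse using (to; from; strictlyInverseˡ)

private
  variable
    A B : Set
    n : ℕ

filter-map : ∀ {p} {P : Pred B p} (P? : Decidable P) (f : A → B) (xs : List A) →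
             filter P? (map f xs) ≡ map f (filter (P? ∘ f) xs)
filter-map P? f []       = refl
filter-map P? f (x ∷ xs) with does (P? (f x))
... | true  = cong (f x ∷_) (filter-map P? f xs)
... | false = filter-map P? f xs

-- Two duplicate-free lists with the same members are permutations of each other. Injectivity of `φ`
-- keeps the image list duplicate-free, and every `x` occurs in it as the image of `from φ x`.
-- Serves to reindex both the bit positions and the words.
map-enumeration-↭ : {xs : List A} → Unique xs → (∀ x → x ∈ xs) →
                    (φ : A ↔ A) → map (to φ) xs ↭ xs
map-enumeration-↭ {xs = xs} unique complete φ =
  ∼bag⇒↭ (unique∧set⇒bag (Unique.map⁺ (Injection.injective (↔⇒↣ φ)) unique) unique
    (mk⇔ (λ _ → complete _)
         (λ _ → subst (_∈ map (to φ) xs) (strictlyInverseˡ φ _)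
                  (∈-map⁺ (to φ) (complete (from φ _))))))

-- A multiset has only one sorted listing, so equality of ordered sensitivity vectors reduces to a
-- permutation of the unsorted ones.
sort-cong-↭ : {xs ys : List ℕ} → xs ↭ ys →
              sort ≤-decTotalOrder xs ≡ sort ≤-decTotalOrder ys
sort-cong-↭ {xs} {ys} xs↭ys = ≋⇒≡ (↗↭↗⇒≋ ≤-totalOrder
  (sort-↗ ≤-decTotalOrder xs) (sort-↗ ≤-decTotalOrder ys)
  (↭⇒↭ₛ (↭-trans (sort-↭ ≤-decTotalOrder xs)
    (↭-trans xs↭ys (↭-sym (sort-↭ ≤-decTotalOrder ys))))))

lookup-injective : {X Y : Word n} → lookup X ≗ lookup Y → X ≡ Y
lookup-injective {X = X} {Y} eq =
  trans (sym (tabulate∘lookup X)) (trans (tabulate-cong eq) (tabulate∘lookup Y))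

selectiveNegation-involutive : (S : Subset n) (X : Word n) →
                               selectiveNegation S (selectiveNegation S X) ≡ X
selectiveNegation-involutive []          []          = refl
selectiveNegation-involutive (false ∷ S) (x ∷ X)     = cong (x ∷_) (selectiveNegation-involutive S X)
selectiveNegation-involutive (true ∷ S)  (false ∷ X) = cong (false ∷_) (selectiveNegation-involutive S X)
selectiveNegation-involutive (true ∷ S)  (true ∷ X)  = cong (true ∷_) (selectiveNegation-involutive S X)

-- `permute` is contravariant: entry `i` of the left side is read from position `ρ (π i)` of `X`. A
-- one-sided hypothesis lets the lemma give both round trips of the bijection below.
permute-inverse : (π ρ : Permutation′ n) → (∀ i → ρ ⟨$⟩ʳ (π ⟨$⟩ʳ i) ≡ i) →
                  (X : Word n) → permute π (permute ρ X) ≡ X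
permute-inverse π ρ ρπ≡id X = lookup-injective λ i → begin
  lookup (permute π (permute ρ X)) i   ≡⟨ lookup∘tabulate _ i ⟩
  lookup (permute ρ X) (π ⟨$⟩ʳ i)      ≡⟨ lookup∘tabulate _ (π ⟨$⟩ʳ i) ⟩
  lookup X (ρ ⟨$⟩ʳ (π ⟨$⟩ʳ i))         ≡⟨ cong (lookup X) (ρπ≡id i) ⟩
  lookup X i                           ∎
  where open ≡-Reasoning

inputTransformation : Permutation′ n → Subset n → Word n ↔ Word n
inputTransformation π S =
  mk↔ₛ′ (permute π) (permute (flip π))
    (permute-inverse π (flip π) λ _ → inverseˡ π)
    (permute-inverse (flip π) π λ _ → inverseʳ π)
  ↔-∘
  mk↔ₛ′ (selectiveNegation S) (selectiveNegation S)
    (selectiveNegation-involutive S) (selectiveNegation-involutive S)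

flipBit-selectiveNegation : (S : Subset n) (X : Word n) (i : Fin n) →
  flipBit (selectiveNegation S X) i ≡ selectiveNegation S (flipBit X i)
flipBit-selectiveNegation (false ∷ S) (x ∷ X) zero    = refl
flipBit-selectiveNegation (true ∷ S)  (x ∷ X) zero    = refl
flipBit-selectiveNegation (s ∷ S)     (x ∷ X) (suc i) =
  cong ((if s then not x else x) ∷_) (flipBit-selectiveNegation S X i)

-- Entry `i` of the permuted word is read from position `π i` of `X`, so that is the bit to flip
-- beforehand.
flipBit-permute : (π : Permutation′ n) (X : Word n) (i : Fin n) →
  flipBit (permute π X) i ≡ permute π (flipBit X (π ⟨$⟩ʳ i))
flipBit-permute π X i = lookup-injective pointwise
  where
  open ≡-Reasoning
  pointwise : lookup (flipBit (permute π X) i) ≗ lookup (permute π (flipBit X (π ⟨$⟩ʳ i)))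
  pointwise j with j ≟ i
  ... | yes refl = begin
    lookup (flipBit (permute π X) i) i                   ≡⟨ lookup∘updateAt i (permute π X) ⟩
    not (lookup (permute π X) i)                         ≡⟨ cong not (lookup∘tabulate _ i) ⟩
    not (lookup X (π ⟨$⟩ʳ i))                            ≡⟨ lookup∘updateAt (π ⟨$⟩ʳ i) X ⟨
    lookup (flipBit X (π ⟨$⟩ʳ i)) (π ⟨$⟩ʳ i)             ≡⟨ lookup∘tabulate _ i ⟨
    lookup (permute π (flipBit X (π ⟨$⟩ʳ i))) i          ∎
  ... | no j≢i = begin
    lookup (flipBit (permute π X) i) j                   ≡⟨ lookup∘updateAt′ j i j≢i (permute π X) ⟩
    lookup (permute π X) j                               ≡⟨ lookup∘tabulate _ j ⟩
    -- Injectivity of `π` gives `π j ≢ π i`, so the flip misses the entry being read.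
    lookup X (π ⟨$⟩ʳ j)                                  ≡⟨ lookup∘updateAt′ _ _ (j≢i ∘ Injection.injective (↔⇒↣ π)) X ⟨
    lookup (flipBit X (π ⟨$⟩ʳ i)) (π ⟨$⟩ʳ j)             ≡⟨ lookup∘tabulate _ j ⟨
    lookup (permute π (flipBit X (π ⟨$⟩ʳ i))) j          ∎

flipBit-inputTransformation : (π : Permutation′ n) (S : Subset n) (X : Word n) (i : Fin n) →
  flipBit (to (inputTransformation π S) X) i ≡ to (inputTransformation π S) (flipBit X (π ⟨$⟩ʳ i))
flipBit-inputTransformation π S X i =
  trans (flipBit-permute π (selectiveNegation S X) i)
        (cong (permute π) (flipBit-selectiveNegation S X (π ⟨$⟩ʳ i)))

-- h is the output transformation: the identity or the negation.
module _ {f g : BoolFun n} (π : Permutation′ n) (S : Subset n)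
         {h : Bool → Bool} (h-injective : Injective _≡_ _≡_ h)
         (hfT≡g : ∀ X → h (f (permute π (selectiveNegation S X))) ≡ g X) where

  private
    T : Word n → Word n
    T = to (inputTransformation π S)

    -- Applying `h` takes values of `f ∘ T` to values of `g`; injectivity of `h` allows it to be
    -- cancelled for the way back.
    f∘T≡⇔g≡ : ∀ X Y → (f (T X) ≡ f (T Y) → g X ≡ g Y) × (g X ≡ g Y → f (T X) ≡ f (T Y))
    f∘T≡⇔g≡ X Y =
      (λ eq → trans (sym (hfT≡g X)) (trans (cong h eq) (hfT≡g Y))) ,
      (λ eq → h-injective (trans (hfT≡g X) (trans eq (sym (hfT≡g Y)))))

  -- The map `i ↦ π i` matches the sensitive positions of `f` at `T X` with those of `g` at `X`, so
  -- the two counts agree.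
  sen-NPN : sen g ≗ sen f ∘ T
  sen-NPN X = begin
    -- The count is unchanged when the positions are listed as `π i` instead of `i`.
    length (filter Q? (allFin n))                         ≡⟨ ↭-length (filter-↭ Q? (map-enumeration-↭ (Unique.allFin⁺ n) ∈-allFin π)) ⟨
    length (filter Q? (map (π ⟨$⟩ʳ_) (allFin n)))         ≡⟨ cong length (filter-map Q? (π ⟨$⟩ʳ_) (allFin n)) ⟩
    length (map (π ⟨$⟩ʳ_) (filter (Q? ∘ (π ⟨$⟩ʳ_)) (allFin n))) ≡⟨ length-map _ (filter (Q? ∘ (π ⟨$⟩ʳ_)) (allFin n)) ⟩
    length (filter (Q? ∘ (π ⟨$⟩ʳ_)) (allFin n))           ≡⟨ cong length (filter-≐ (Q? ∘ (π ⟨$⟩ʳ_)) P? (Q⇒P , P⇒Q) (allFin n)) ⟩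
    length (filter P? (allFin n))                         ∎
    where
    open ≡-Reasoning
    Q? = λ i → ¬? (g X ≟ᵇ g (flipBit X i))
    P? = λ i → ¬? (f (T X) ≟ᵇ f (flipBit (T X) i))
    flip-T = flipBit-inputTransformation π S X
    Q⇒P : ∀ {i} → ¬ (g X ≡ g (flipBit X (π ⟨$⟩ʳ i))) → ¬ (f (T X) ≡ f (flipBit (T X) i))
    Q⇒P {i} g≢ f≡ = g≢ (proj₁ (f∘T≡⇔g≡ X _) (trans f≡ (cong f (flip-T i))))
    P⇒Q : ∀ {i} → ¬ (f (T X) ≡ f (flipBit (T X) i)) → ¬ (g X ≡ g (flipBit X (π ⟨$⟩ʳ i)))
    P⇒Q {i} f≢ g≡ = f≢ (trans (proj₂ (f∘T≡⇔g≡ X _) g≡) (cong f (sym (flip-T i))))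

  -- `T` restricts to a bijection from the words where `g` is `h b` to those where `f` is `b`, and
  -- `sen-NPN` says that it preserves sensitivity.
  OSV-NPN : ∀ b → OSV b f ≡ OSV (h b) g
  OSV-NPN b = sort-cong-↭ (begin
    -- Listing all words as images under `T` turns the preimage under `f` into a condition on
    -- `f ∘ T`.
    map (sen f) (filter F? (words n))                ↭⟨ map⁺ (sen f) (filter-↭ F? (map-enumeration-↭ (words-unique n) ∈-words (inputTransformation π S))) ⟨
    map (sen f) (filter F? (map T (words n)))        ≡⟨ cong (map (sen f)) (filter-map F? T (words n)) ⟩
    map (sen f) (map T (filter (F? ∘ T) (words n)))  ≡⟨ map-∘ (filter (F? ∘ T) (words n)) ⟨
    map (sen f ∘ T) (filter (F? ∘ T) (words n))      ≡⟨ map-cong sen-NPN (filter (F? ∘ T) (words n)) ⟨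
    map (sen g) (filter (F? ∘ T) (words n))          ≡⟨ cong (map (sen g)) (filter-≐ (F? ∘ T) G? (F⇒G , G⇒F) (words n)) ⟩
    map (sen g) (filter G? (words n))                ∎)
    where
    open PermutationReasoning
    F? = λ X → f X ≟ᵇ b
    G? = λ X → g X ≟ᵇ h b
    F⇒G : ∀ {X} → f (T X) ≡ b → g X ≡ h b
    F⇒G {X} eq = trans (sym (hfT≡g X)) (cong h eq)
    G⇒F : ∀ {X} → g X ≡ h b → f (T X) ≡ b
    G⇒F {X} eq = h-injective (trans (hfT≡g X) eq)

theorem3 : ∀ (n : ℕ) (f g : BoolFun n) → Balanced f → Balanced g → NPNEquivalent f g →
    (OSV true f ≡ OSV true g × OSV false f ≡ OSV false g)
    ⊎ (OSV true f ≡ OSV false g × OSV false f ≡ OSV true g)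
theorem3 n f g _ _ (π , S , inj₁ fT≡g) = inj₁ (osv true , osv false)
  -- The second `id` is the proof that the identity is injective.
  where osv = OSV-NPN π S {h = id} id fT≡g
theorem3 n f g _ _ (π , S , inj₂ ¬fT≡g) = inj₂ (osv true , osv false)
  -- Here `h b` computes to the opposite bit, which exchanges the two vectors of `g`.
  where osv = OSV-NPN π S {h = not} not-injective ¬fT≡g
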